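{- For every integer $n\geq 1$, $$A_{N>O}(n)-B_{N>O}(n)=2p_e(n).$$
   Context: A partition of $n$ is a finite non-increasing sequence of positive integers (its parts) with sum $n$. An overpartition of $n$ is a partition of $n$ in which the first occurrence of each number may be overlined (so for each size $t$ at most one part of size $t$ is overlined); the size of a part $t$ or $\overline{t}$ is $t$, and the weight is the sum of sizes. For an overpartition $\pi$, let $SO(\pi)$ be the size of the smallest overlined part of $\pi$ if $\pi$ has overlined parts, and $SO(\pi)=0$ otherwise. Let $\ell_{N>O}(\pi)$ be the number of non-overlined parts of $\pi$ (counted with multiplicity) of size greater than $SO(\pi)$. $A_{N>O}(n)$ (resp. $B_{N>O}(n)$) is the number of overpartitions $\pi$ of $n$ with $\ell_{N>O}(\pi)$ even (resp. odd). $p_e(n)$ is the number of (ordinary) partitions of $n$ with an even number of parts. -}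

module Defs where

open import Data.Bool using (Bool; true; false)
import Data.Bool.Properties as Bool
open import Data.List using (List; []; _∷_; [_]; length; map; filter; foldr; upTo; cartesianProductWith)
open import Data.Nat.ListAction using (sum)
open import Data.List.Membership.Propositional using (_∈_)
open import Data.List.Membership.Propositional.Properties
  using (∈-filter⁺; ∈-filter⁻; ∈-cartesianProductWith⁺; ∈-cartesianProductWith⁻; ∈-upTo⁺)
open import Data.List.Properties using (length-map)
open import Data.List.Relation.Unary.All as All using (All; []; _∷_)
import Data.List.Relation.Unary.All.Properties as All
open import Data.List.Relation.Unary.AllPairs as AllPairs using (AllPairs; []; _∷_)
open import Data.List.Relation.Unary.Any using (here; there)
open import Data.List.Relation.Unary.Linked as Linked using (Linked)
open import Data.List.Relation.Unary.Unique.Propositional using (Unique)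
import Data.List.Relation.Unary.Unique.Propositional.Properties as Unique
open import Data.Nat
open import Data.Nat.Properties
open import Data.Parity using (Parity; 0ℙ; 1ℙ)
import Data.Parity.Properties as ℙ
open import Data.Product using (_×_; _,_; proj₁; proj₂)
open import Function using (_∘_; _⇔_; mk⇔)
open import Relation.Binary.PropositionalEquality using (_≡_; refl; sym; subst)
import Relation.Nullary.Decidable as Dec
open import Relation.Nullary using (_×-dec_; _→-dec_)
open import Relation.Unary using (Decidable)

record IsPartition (n : ℕ) (λs : List ℕ) : Set where
  constructor isPartition
  field
    positive      : All (1 ≤_) λs
    nonIncreasing : Linked _≥_ λs
    weight        : sum λs ≡ n

record Part : Set where
  constructor part
  field
    size      : ℕ
    overlined : Bool

open Part public

-- Related pairs are (earlier part, later part) of a list: a part may be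
-- overlined only if no earlier part has the same size.
OverlinedFirst : Part → Part → Set
OverlinedFirst x y = size x ≡ size y → overlined y ≡ false

record IsOverpartition (n : ℕ) (π : List Part) : Set where
  constructor isOverpartition
  field
    sizes          : IsPartition n (map size π)
    overlinedFirst : AllPairs OverlinedFirst π

-- The value at [] gives SO π = 0 when π has no overlined part.
minimum₀ : List ℕ → ℕ
minimum₀ []       = 0
minimum₀ (x ∷ xs) = foldr _⊓_ x xs

SO : List Part → ℕ
SO π = minimum₀ (map size (filter (λ x → overlined x Bool.≟ true) π))

ℓ-N>O : List Part → ℕ
ℓ-N>O π = length (filter (λ x → (overlined x Bool.≟ false) ×-dec (SO π <? size x)) π)

Even Odd : ℕ → Set
Even m = parity m ≡ 0ℙ
Odd  m = parity m ≡ 1ℙ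

even? : Decidable Even
even? m = parity m ℙ.≟ 0ℙ

odd? : Decidable Odd
odd? m = parity m ℙ.≟ 1ℙ

isPartition? : ∀ n → Decidable (IsPartition n)
isPartition? n λs = Dec.map′ (λ (p , l , w) → isPartition p l w)
  (λ (isPartition p l w) → p , l , w)
  (All.all? (1 ≤?_) λs ×-dec Linked.linked? _≥?_ λs ×-dec (sum λs ≟ n))

isOverpartition? : ∀ n → Decidable (IsOverpartition n)
isOverpartition? n π = Dec.map′ (λ (s , o) → isOverpartition s o)
  (λ (isOverpartition s o) → s , o)
  (isPartition? n (map size π) ×-dec
   AllPairs.allPairs? (λ x y → (size x ≟ size y) →-dec (overlined y Bool.≟ false)) π)

-- All lists of length at most k with entries from as.
words : {A : Set} → ℕ → List A → List (List A)
words zero    as = [ [] ]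
words (suc k) as = [] ∷ cartesianProductWith _∷_ as (words k as)

candidateParts : ℕ → List Part
candidateParts n = cartesianProductWith part (upTo (suc n)) (true ∷ false ∷ [])

-- The bounds lose nothing: an (over)partition of n has at most n parts, each
-- of size at most n.  See ∈-partitions, ∈-overpartitions and the two
-- uniqueness lemmas below.
partitions : ℕ → List (List ℕ)
partitions n = filter (isPartition? n) (words n (upTo (suc n)))

overpartitions : ℕ → List (List Part)
overpartitions n = filter (isOverpartition? n) (words n (candidateParts n))

A-N>O B-N>O pₑ : ℕ → ℕ
A-N>O n = length (filter (even? ∘ ℓ-N>O) (overpartitions n))
B-N>O n = length (filter (odd? ∘ ℓ-N>O) (overpartitions n))
pₑ    n = length (filter (even? ∘ length) (partitions n))

words-complete : ∀ {A : Set} {as : List A} k {w} → length w ≤ k → All (_∈ as) w → w ∈ words k as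
words-complete zero    {[]}    _       _        = here refl
words-complete (suc k) {[]}    _       _        = here refl
words-complete (suc k) {x ∷ w} (s≤s l) (p ∷ ps) =
  there (∈-cartesianProductWith⁺ _∷_ p (words-complete k l ps))

words-unique : ∀ {A : Set} {as : List A} k → Unique as → Unique (words k as)
words-unique zero    u = [] ∷ []
words-unique {as = as} (suc k) u =
  All.tabulate (λ w∈ []≡w → nonempty (subst (_∈ _) (sym []≡w) w∈)) ∷
  Unique.cartesianProductWith⁺ _∷_ (λ { refl → refl , refl }) u (words-unique k u)
  where
  open import Data.Empty using (⊥)
  nonempty : [] ∈ cartesianProductWith _∷_ as (words k as) → ⊥
  nonempty p with ∈-cartesianProductWith⁻ _∷_ as (words k as) p
  ... | _ , _ , _ , _ , ()

length≤sum : ∀ {xs} → All (1 ≤_) xs → length xs ≤ sum xs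
length≤sum []       = z≤n
length≤sum (p ∷ ps) = +-mono-≤ p (length≤sum ps)

all≤sum : ∀ xs → All (_≤ sum xs) xs
all≤sum []       = []
all≤sum (x ∷ xs) = m≤m+n x (sum xs) ∷ All.map (λ p → ≤-trans p (m≤n+m (sum xs) x)) (all≤sum xs)

∈-partitions : ∀ {n λs} → λs ∈ partitions n ⇔ IsPartition n λs
∈-partitions {n} {λs} = mk⇔
  (proj₂ ∘ ∈-filter⁻ (isPartition? n) {xs = words n (upTo (suc n))})
  λ { p@(isPartition pos _ refl) → ∈-filter⁺ (isPartition? n)
        (words-complete n (length≤sum pos) (All.map (∈-upTo⁺ ∘ s≤s) (all≤sum λs))) p }

partitions-unique : ∀ n → Unique (partitions n)
partitions-unique n = Unique.filter⁺ (isPartition? n) (words-unique n (Unique.upTo⁺ (suc n)))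

∈-candidateParts : ∀ {n} x → size x ≤ n → x ∈ candidateParts n
∈-candidateParts (part s true)  s≤n = ∈-cartesianProductWith⁺ part (∈-upTo⁺ (s≤s s≤n)) (here refl)
∈-candidateParts (part s false) s≤n = ∈-cartesianProductWith⁺ part (∈-upTo⁺ (s≤s s≤n)) (there (here refl))

∈-overpartitions : ∀ {n π} → π ∈ overpartitions n ⇔ IsOverpartition n π
∈-overpartitions {n} {π} = mk⇔
  (proj₂ ∘ ∈-filter⁻ (isOverpartition? n) {xs = words n (candidateParts n)})
  λ { p@(isOverpartition (isPartition pos _ refl) _) → ∈-filter⁺ (isOverpartition? n)
        (words-complete n
          (subst (_≤ n) (length-map size π) (length≤sum pos))
          (All.map (∈-candidateParts _) (All.map⁻ (all≤sum (map size π))))) p }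

overpartitions-unique : ∀ n → Unique (overpartitions n)
overpartitions-unique n = Unique.filter⁺ (isOverpartition? n) (words-unique n
  (Unique.cartesianProductWith⁺ part (λ { refl → refl , refl }) (Unique.upTo⁺ (suc n))
    (((λ ()) ∷ []) ∷ [] ∷ [])))

{-# OPTIONS --safe #-}

-- Toggling the overline of the largest part (the head) is an involution on the
-- overpartitions with an overlined part in the tail.  That part is smaller than
-- the head, so SO is unchanged and ℓ-N>O changes by one: these overpartitions
-- cancel in A − B.  What remains is, for every partition of n ≥ 1, its copy
-- without overlines, where ℓ-N>O is the number of parts, and its copy with
-- exactly the head overlined, where ℓ-N>O = 0.  Hence A − B = (pₑ − pₒ) + (pₑ + pₒ).
module Submission where

open import Defs
open import Data.Bool using (true; false; not)
import Data.Bool.Properties as Bool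
open import Data.Integer using (ℤ; +_; -_; _-_; _*_; 0ℤ; 1ℤ; -1ℤ) renaming (_+_ to _+ᶻ_)
import Data.Integer.Properties as ℤ
open import Data.Integer.Tactic.RingSolver using (solve-∀)
open import Data.List using (List; []; _∷_; _++_; length; map; filter; foldr; drop)
open import Data.List.Membership.Propositional using (_∈_)
open import Data.List.Membership.Propositional.Properties
open import Data.List.Membership.Propositional.Properties.WithK using (unique∧set⇒bag)
open import Data.List.Properties using (length-map; filter-all; filter-none; filter-accept)
open import Data.List.Relation.Binary.BagAndSetEquality using (∼bag⇒↭)
open import Data.List.Relation.Binary.Permutation.Propositional using (_↭_; ↭⇒↭ₛ)
import Data.List.Relation.Binary.Permutation.Propositional.Properties as Perm
import Data.List.Relation.Binary.Permutation.Setoid.Properties as PermSetoid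
open import Data.List.Relation.Unary.All as All using (All; []; _∷_)
import Data.List.Relation.Unary.All.Properties as All
open import Data.List.Relation.Unary.AllPairs as AllPairs using (AllPairs; []; _∷_)
open import Data.List.Relation.Unary.Any as Any using (Any; here; there)
open import Data.List.Relation.Unary.Linked using (Linked)
open import Data.List.Relation.Unary.Linked.Properties using (Linked⇒AllPairs)
open import Data.List.Relation.Unary.Unique.Propositional using (Unique)
import Data.List.Relation.Unary.Unique.Propositional.Properties as Unique
open import Data.Nat using (ℕ; zero; suc; _≤_; _<_; _≥_; _⊓_; _<?_; parity)
open import Data.Nat.Properties
open import Data.Parity using (Parity; 0ℙ; 1ℙ; _⁻¹)
open import Data.Parity.Properties using (suc-homo-⁻¹)
open import Data.Product using (_×_; _,_; proj₁; proj₂)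
open import Data.Sum using (inj₁; inj₂)
open import Function using (_∘_; _⇔_; mk⇔; Equivalence)
open import Relation.Binary.PropositionalEquality
open import Relation.Nullary using (¬_; yes; no; contradiction; _×-dec_)
open import Relation.Unary using (Decidable)

-- Lists as finite sets, and sums of signs.

private variable
  A B : Set

-- Without repetitions every multiplicity is 0 or 1, so membership determines the list up to order.
-- Bijections between enumerated classes thus reduce to membership arguments.
Unique-set⇒↭ : {xs ys : List A} → Unique xs → Unique ys → (∀ {x} → x ∈ xs ⇔ x ∈ ys) → xs ↭ ys
Unique-set⇒↭ xs! ys! eq = ∼bag⇒↭ (unique∧set⇒bag xs! ys! eq)

sign : Parity → ℤ
sign 0ℙ = 1ℤ
sign 1ℙ = -1ℤ

sign-⁻¹ : ∀ p → sign (p ⁻¹) ≡ - sign p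
sign-⁻¹ 0ℙ = refl
sign-⁻¹ 1ℙ = refl

sumℤ : List ℤ → ℤ
sumℤ = foldr _+ᶻ_ 0ℤ

signedCount : (A → ℕ) → List A → ℤ
signedCount f xs = sumℤ (map (sign ∘ parity ∘ f) xs)

-- Turns a difference of two counts into one sum of terms (-1)^(f x), which is additive over
-- disjoint classes and invariant under reordering.
signedCount-even-odd : ∀ (f : A → ℕ) xs →
  signedCount f xs ≡ + length (filter (even? ∘ f) xs) - + length (filter (odd? ∘ f) xs)
signedCount-even-odd f []       = refl
signedCount-even-odd f (x ∷ xs) with parity (f x)
... | 0ℙ = trans (cong (1ℤ +ᶻ_) (signedCount-even-odd f xs))
             (sym (ℤ.+-assoc 1ℤ (+ length (filter (even? ∘ f) xs)) (- + length (filter (odd? ∘ f) xs))))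
... | 1ℙ = trans (cong (-1ℤ +ᶻ_) (signedCount-even-odd f xs))
             (absorb-odd (+ length (filter (even? ∘ f) xs)) (+ length (filter (odd? ∘ f) xs)))
  where
  absorb-odd : ∀ a b → -1ℤ +ᶻ (a - b) ≡ a - (1ℤ +ᶻ b)
  absorb-odd = solve-∀

length-even-odd : ∀ (f : A → ℕ) xs →
  + length xs ≡ + length (filter (even? ∘ f) xs) +ᶻ + length (filter (odd? ∘ f) xs)
length-even-odd f []       = refl
length-even-odd f (x ∷ xs) with parity (f x)
... | 0ℙ = cong (1ℤ +ᶻ_) (length-even-odd f xs)
... | 1ℙ = trans (cong (1ℤ +ᶻ_) (length-even-odd f xs))
             (absorb-odd (+ length (filter (even? ∘ f) xs)) (+ length (filter (odd? ∘ f) xs)))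
  where
  absorb-odd : ∀ a b → 1ℤ +ᶻ (a +ᶻ b) ≡ a +ᶻ (1ℤ +ᶻ b)
  absorb-odd = solve-∀

signedCount-↭ : ∀ (f : A → ℕ) {xs ys} → xs ↭ ys → signedCount f xs ≡ signedCount f ys
signedCount-↭ f p =
  PermSetoid.foldr-commMonoid (setoid ℤ) ℤ.+-0-isCommutativeMonoid (↭⇒↭ₛ (Perm.map⁺ (sign ∘ parity ∘ f) p))

signedCount-++ : ∀ (f : A → ℕ) xs ys → signedCount f (xs ++ ys) ≡ signedCount f xs +ᶻ signedCount f ys
signedCount-++ f []       ys = sym (ℤ.+-identityˡ _)
signedCount-++ f (x ∷ xs) ys =
  trans (cong (sign (parity (f x)) +ᶻ_) (signedCount-++ f xs ys)) (sym (ℤ.+-assoc (sign (parity (f x))) _ _))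

signedCount-map : ∀ (f : B → ℕ) (g : A → B) (h : A → ℕ) {xs} →
  All (λ x → f (g x) ≡ h x) xs → signedCount f (map g xs) ≡ signedCount h xs
signedCount-map f g h []         = refl
signedCount-map f g h (eq ∷ eqs) = cong₂ _+ᶻ_ (cong (sign ∘ parity) eq) (signedCount-map f g h eqs)

signedCount-map-flip : ∀ (f : A → ℕ) (g : A → A) {xs} →
  All (λ x → parity (f (g x)) ≡ parity (f x) ⁻¹) xs → signedCount f (map g xs) ≡ - signedCount f xs
signedCount-map-flip f g []                   = refl
signedCount-map-flip f g {x ∷ xs} (eq ∷ eqs) = trans
  (cong₂ _+ᶻ_ (trans (cong sign eq) (sign-⁻¹ (parity (f x)))) (signedCount-map-flip f g eqs))
  (sym (ℤ.neg-distrib-+ (sign (parity (f x))) _))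

signedCount-const-0 : ∀ (xs : List A) → signedCount (λ _ → 0) xs ≡ + length xs
signedCount-const-0 []       = refl
signedCount-const-0 (x ∷ xs) = cong (1ℤ +ᶻ_) (signedCount-const-0 xs)

i≡-i⇒i≡0 : ∀ i → i ≡ - i → i ≡ 0ℤ
-- Negating a nonzero integer switches its constructor, so the equation rules out all other cases by
-- unification.
i≡-i⇒i≡0 (+ zero) _ = refl

-- Copies of partitions, and toggling the head.

plain marked : List ℕ → List Part
plain = map (λ s → part s false)
marked []       = []
marked (s ∷ λs) = part s true ∷ plain λs

toggle : List Part → List Part
toggle []             = []
toggle (part s b ∷ π) = part s (not b) ∷ π

Overlined : Part → Set
Overlined x = overlined x ≡ true

OverlinedTail : List Part → Set
OverlinedTail π = Any Overlined (drop 1 π)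

overlinedTail? : Decidable OverlinedTail
overlinedTail? π = Any.any? (λ x → overlined x Bool.≟ true) (drop 1 π)

overlinedTails : ℕ → List (List Part)
overlinedTails n = filter overlinedTail? (overpartitions n)

∈-overlinedTails⁻ : ∀ n {π} → π ∈ overlinedTails n → IsOverpartition n π × OverlinedTail π
∈-overlinedTails⁻ n p with ∈-filter⁻ overlinedTail? {xs = overpartitions n} p
... | q , t = Equivalence.to ∈-overpartitions q , t

∈-overlinedTails⁺ : ∀ {n π} → IsOverpartition n π → OverlinedTail π → π ∈ overlinedTails n
∈-overlinedTails⁺ o t = ∈-filter⁺ overlinedTail? (Equivalence.from ∈-overpartitions o) t

sizes-plain : ∀ λs → map size (plain λs) ≡ λs
sizes-plain []       = refl
sizes-plain (s ∷ λs) = cong (s ∷_) (sizes-plain λs)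

sizes-marked : ∀ λs → map size (marked λs) ≡ λs
sizes-marked []       = refl
sizes-marked (s ∷ λs) = cong (s ∷_) (sizes-plain λs)

plain-injective : ∀ {λs μs} → plain λs ≡ plain μs → λs ≡ μs
plain-injective eq = trans (sym (sizes-plain _)) (trans (cong (map size) eq) (sizes-plain _))

marked-injective : ∀ {λs μs} → marked λs ≡ marked μs → λs ≡ μs
marked-injective eq = trans (sym (sizes-marked _)) (trans (cong (map size) eq) (sizes-marked _))

toggle-involutive : ∀ π → toggle (toggle π) ≡ π
toggle-involutive []             = refl
toggle-involutive (part s b ∷ π) = cong (λ b → part s b ∷ π) (Bool.not-involutive b)

toggle-injective : ∀ {π ρ} → toggle π ≡ toggle ρ → π ≡ ρ
toggle-injective eq = trans (sym (toggle-involutive _)) (trans (cong toggle eq) (toggle-involutive _))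

All-plain : ∀ {P : Part → Set} → (∀ s → P (part s false)) → ∀ λs → All P (plain λs)
All-plain p λs = All.map⁺ (All.universal p λs)

¬overlined-plain : ∀ λs → ¬ Any Overlined (plain λs)
¬overlined-plain λs = All.All¬⇒¬Any (All-plain (λ _ ()) λs)

plain-overlinedFirst : ∀ λs → AllPairs OverlinedFirst (plain λs)
plain-overlinedFirst []       = []
plain-overlinedFirst (s ∷ λs) = All-plain (λ _ _ → refl) λs ∷ plain-overlinedFirst λs

plain-isOverpartition : ∀ {n λs} → IsPartition n λs → IsOverpartition n (plain λs)
plain-isOverpartition {n} {λs} p = isOverpartition
  (subst (IsPartition n) (sym (sizes-plain λs)) p) (plain-overlinedFirst λs)

marked-overlinedFirst : ∀ λs → AllPairs OverlinedFirst (marked λs)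
marked-overlinedFirst []       = []
marked-overlinedFirst (s ∷ λs) = All-plain (λ _ _ → refl) λs ∷ plain-overlinedFirst λs

marked-isOverpartition : ∀ {n λs} → IsPartition n λs → IsOverpartition n (marked λs)
marked-isOverpartition {n} {λs} p = isOverpartition
  (subst (IsPartition n) (sym (sizes-marked λs)) p) (marked-overlinedFirst λs)

-- `OverlinedFirst` restricts only the overline of the later part of a pair. The head is never the
-- later one, so its overline is free and the same evidence serves both versions.
toggle-isOverpartition : ∀ {n π} → IsOverpartition n π → IsOverpartition n (toggle π)
toggle-isOverpartition {π = []}    o                          = o
toggle-isOverpartition {π = _ ∷ _} (isOverpartition s (p ∷ ps)) = isOverpartition s (p ∷ ps)

toggle-overlinedTail : ∀ π → OverlinedTail π → OverlinedTail (toggle π)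
toggle-overlinedTail (_ ∷ _) t = t

¬overlined⇒plain : ∀ π → ¬ Any Overlined π → π ≡ plain (map size π)
¬overlined⇒plain []                 _  = refl
¬overlined⇒plain (part s true ∷ π)  ¬o = contradiction (here refl) ¬o
¬overlined⇒plain (part s false ∷ π) ¬o = cong (part s false ∷_) (¬overlined⇒plain π (¬o ∘ there))

nonIncreasing⇒All≤head : ∀ {s λs} → Linked _≥_ (s ∷ λs) → All (_≤ s) λs
nonIncreasing⇒All≤head = AllPairs.head ∘ Linked⇒AllPairs (λ p q → ≤-trans q p)

-- The statistic on plain and marked copies.

ℓ-plain : ∀ {n λs} → IsPartition n λs → ℓ-N>O (plain λs) ≡ length λs
ℓ-plain {λs = λs} (isPartition pos _ _)
  -- With nothing overlined, `SO` takes its default value 0, and every part is positive, hence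
  -- counted.
  rewrite filter-none (λ x → overlined x Bool.≟ true) (All-plain (λ _ ()) λs)
        | filter-all (λ x → (overlined x Bool.≟ false) ×-dec (0 <? size x))
            {plain λs} (All.map⁺ (All.map (refl ,_) pos))
  = length-map _ λs

ℓ-marked : ∀ {n λs} → IsPartition n λs → ℓ-N>O (marked λs) ≡ 0
ℓ-marked {λs = []}     _ = refl
ℓ-marked {λs = s ∷ λs} (isPartition _ dec _)
  -- The head is the only overlined part, so `SO` is the largest size and no part exceeds it.
  rewrite filter-none (λ x → overlined x Bool.≟ true) (All-plain (λ _ ()) λs)
        | filter-none (λ x → (overlined x Bool.≟ false) ×-dec (s <? size x)) {plain λs}
            (All.map⁺ (All.map (λ t≤s (_ , s<t) → <⇒≱ s<t t≤s) (nonIncreasing⇒All≤head dec)))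
  = refl

-- The effect of the head's overline on `SO` and `ℓ-N>O`.

foldr-⊓-absorb : ∀ {s y} → y ≤ s → ∀ ys → y ⊓ foldr _⊓_ s ys ≡ foldr _⊓_ y ys
foldr-⊓-absorb         y≤s []       = m≤n⇒m⊓n≡m y≤s
foldr-⊓-absorb {s} {y} y≤s (z ∷ zs) = begin
  -- Carry `y` inward past each entry until it meets the seed `s`, which it absorbs because `y ≤ s`.
  y ⊓ (z ⊓ foldr _⊓_ s zs) ≡⟨ ⊓-assoc y z _ ⟨
  (y ⊓ z) ⊓ foldr _⊓_ s zs ≡⟨ cong (_⊓ _) (⊓-comm y z) ⟩
  (z ⊓ y) ⊓ foldr _⊓_ s zs ≡⟨ ⊓-assoc z y _ ⟩
  z ⊓ (y ⊓ foldr _⊓_ s zs) ≡⟨ cong (z ⊓_) (foldr-⊓-absorb y≤s zs) ⟩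
  z ⊓ foldr _⊓_ y zs       ∎
  where open ≡-Reasoning

foldr-⊓≤ : ∀ y ys → foldr _⊓_ y ys ≤ y
foldr-⊓≤ y []       = ≤-refl
foldr-⊓≤ y (z ∷ zs) = ≤-trans (m⊓n≤n z _) (foldr-⊓≤ y zs)

-- Sizes weakly decrease, and an overlined part of the same size as the head would not be the first
-- of that size.
overlined<head : ∀ {n x π} → IsOverpartition n (x ∷ π) → All (λ y → Overlined y → size y < size x) π
overlined<head {x = x} (isOverpartition (isPartition _ dec _) (first ∷ _)) =
  All.zipWith strict (All.map⁻ (nonIncreasing⇒All≤head dec) , first)
  where
  strict : ∀ {y} → size y ≤ size x × OverlinedFirst x y → Overlined y → size y < size x
  strict (y≤x , f) o = ≤∧≢⇒< y≤x λ eq → contradiction (trans (sym o) (f (sym eq))) λ ()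

overlinedSizes : List Part → List ℕ
overlinedSizes π = map size (filter (λ x → overlined x Bool.≟ true) π)

overlinedSizes-< : ∀ {s} π → All (λ y → Overlined y → size y < s) π → All (_< s) (overlinedSizes π)
overlinedSizes-< []                 []       = []
overlinedSizes-< (part _ true ∷ π)  (p ∷ ps) = p refl ∷ overlinedSizes-< π ps
overlinedSizes-< (part _ false ∷ π) (p ∷ ps) = overlinedSizes-< π ps

overlinedSizes-nonempty : ∀ {π} → Any Overlined π → overlinedSizes π ≢ []
overlinedSizes-nonempty {part _ true ∷ _}  _         ()
overlinedSizes-nonempty {part _ false ∷ _} (there o) eq = overlinedSizes-nonempty o eq

-- `minimum₀` uses the first entry as its seed, so prepending `s` changes the seed, and a smaller
-- entry makes this harmless. For empty `ys` the two sides would be `s` and the default 0.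
minimum₀-∷ : ∀ {s ys} → All (_< s) ys → ys ≢ [] → minimum₀ (s ∷ ys) ≡ minimum₀ ys
minimum₀-∷ {ys = []}     _       ≢[] = contradiction refl ≢[]
minimum₀-∷ {ys = y ∷ ys} (p ∷ _) _   = foldr-⊓-absorb (<⇒≤ p) ys

minimum₀-< : ∀ {s ys} → All (_< s) ys → ys ≢ [] → minimum₀ ys < s
minimum₀-< {ys = []}     _       ≢[] = contradiction refl ≢[]
minimum₀-< {ys = y ∷ ys} (p ∷ _) _   = ≤-<-trans (foldr-⊓≤ y ys) p

-- The overlined part in the tail lies below the head, so `SO` is the same on both sides. The tail
-- then contributes equally, and the head, which exceeds `SO`, is counted exactly when it is not
-- overlined.
ℓ-unmark : ∀ {s π} → All (λ y → Overlined y → size y < s) π → Any Overlined π →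
  ℓ-N>O (part s false ∷ π) ≡ suc (ℓ-N>O (part s true ∷ π))
ℓ-unmark {s} {π} lt o
  rewrite minimum₀-∷ (overlinedSizes-< π lt) (overlinedSizes-nonempty o)
  = cong length (filter-accept (λ x → (overlined x Bool.≟ false) ×-dec (SO π <? size x))
      (refl , minimum₀-< (overlinedSizes-< π lt) (overlinedSizes-nonempty o)))

parity-toggle : ∀ {n π} → IsOverpartition n π → OverlinedTail π →
  parity (ℓ-N>O (toggle π)) ≡ parity (ℓ-N>O π) ⁻¹
parity-toggle {π = part s true ∷ π}  o t = trans (cong parity (ℓ-unmark (overlined<head o) t))
  -- `parity` recurses in steps of two, so the parity of the double successor arising here reduces
  -- to that of the original number.
  (sym (suc-homo-⁻¹ (suc (ℓ-N>O (part s true ∷ π)))))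
parity-toggle {π = part s false ∷ π} o t = trans
  (sym (suc-homo-⁻¹ (ℓ-N>O (part s true ∷ π)))) (cong (_⁻¹ ∘ parity) (sym (ℓ-unmark (overlined<head o) t)))

-- Cancellation, and the decomposition into three classes.

toggle-↭ : ∀ n → overlinedTails n ↭ map toggle (overlinedTails n)
toggle-↭ n = Unique-set⇒↭ tails! (Unique.map⁺ toggle-injective tails!) (mk⇔ to from)
  where
  tails! : Unique (overlinedTails n)
  tails! = Unique.filter⁺ overlinedTail? (overpartitions-unique n)
  closed : ∀ {π} → π ∈ overlinedTails n → toggle π ∈ overlinedTails n
  closed {π} p with ∈-overlinedTails⁻ n p
  ... | o , t = ∈-overlinedTails⁺ (toggle-isOverpartition o) (toggle-overlinedTail π t)
  to : ∀ {π} → π ∈ overlinedTails n → π ∈ map toggle (overlinedTails n)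
  to p = subst (_∈ map toggle (overlinedTails n)) (toggle-involutive _) (∈-map⁺ toggle (closed p))
  from : ∀ {π} → π ∈ map toggle (overlinedTails n) → π ∈ overlinedTails n
  from p with ∈-map⁻ toggle p
  ... | _ , q , refl = closed q

-- Reordering the class by `toggle` preserves the sum, while the parity change negates every term,
-- so the sum is its own negative.
overlinedTails-cancel : ∀ n → signedCount ℓ-N>O (overlinedTails n) ≡ 0ℤ
overlinedTails-cancel n = i≡-i⇒i≡0 _ (trans (signedCount-↭ ℓ-N>O (toggle-↭ n))
  (signedCount-map-flip ℓ-N>O toggle (All.tabulate λ p →
    let o , t = ∈-overlinedTails⁻ n p in parity-toggle o t)))

-- Either the tail has an overlined part, or the overpartition is fixed by its sizes and the head's
-- overline, which makes it a plain or a marked copy.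
overpartitions-↭ : ∀ n → n ≥ 1 →
  overpartitions n ↭ map plain (partitions n) ++ map marked (partitions n) ++ overlinedTails n
overpartitions-↭ n n≥1 = Unique-set⇒↭ (overpartitions-unique n)
  (Unique.++⁺ (Unique.map⁺ plain-injective (partitions-unique n))
    (Unique.++⁺ (Unique.map⁺ marked-injective (partitions-unique n))
      (Unique.filter⁺ overlinedTail? (overpartitions-unique n)) marked#tails)
    plain#rest)
  (mk⇔ (λ p → to (Equivalence.to ∈-overpartitions p)) (Equivalence.from ∈-overpartitions ∘ from))
  where
  ps = partitions n

  -- This is where `n ≥ 1` enters: `plain []` and `marked []` coincide, so the empty partition would
  -- break disjointness.
  nonempty : ¬ IsPartition n []
  nonempty (isPartition _ _ eq) = contradiction eq (<⇒≢ n≥1)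

  marked#tails : ∀ {π} → ¬ (π ∈ map marked ps × π ∈ overlinedTails n)
  marked#tails (p , q) with ∈-map⁻ marked p | ∈-overlinedTails⁻ n q
  ... | []     , _ , refl | _ , ()
  ... | _ ∷ λs , _ , refl | _ , t = ¬overlined-plain λs t

  plain#rest : ∀ {π} → ¬ (π ∈ map plain ps × π ∈ map marked ps ++ overlinedTails n)
  plain#rest (p , q) with ∈-map⁻ plain p | ∈-++⁻ (map marked ps) q
  ... | [] , r , refl | _ = nonempty (Equivalence.to ∈-partitions r)
  ... | _ ∷ λs , _ , refl | inj₂ q′ = ¬overlined-plain λs (proj₂ (∈-overlinedTails⁻ n q′))
  -- A plain copy with at least one part differs from any marked copy already in its head.
  ... | _ ∷ λs , _ , refl | inj₁ q′ with ∈-map⁻ marked q′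
  ...   | []    , _ , ()
  ...   | _ ∷ _ , _ , ()

  to : ∀ {π} → IsOverpartition n π → π ∈ map plain ps ++ map marked ps ++ overlinedTails n
  to {π} o with overlinedTail? π
  to o | yes t = ∈-++⁺ʳ (map plain ps) (∈-++⁺ʳ (map marked ps) (∈-overlinedTails⁺ o t))
  to {[]} o | no _ = contradiction (IsOverpartition.sizes o) nonempty
  to {part s false ∷ π} o | no ¬t = ∈-++⁺ˡ (subst (_∈ map plain ps)
    (cong (part s false ∷_) (sym (¬overlined⇒plain π ¬t)))
    (∈-map⁺ plain (Equivalence.from ∈-partitions (IsOverpartition.sizes o))))
  to {part s true ∷ π} o | no ¬t = ∈-++⁺ʳ (map plain ps) (∈-++⁺ˡ (subst (_∈ map marked ps)
    (cong (part s true ∷_) (sym (¬overlined⇒plain π ¬t)))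
    (∈-map⁺ marked (Equivalence.from ∈-partitions (IsOverpartition.sizes o)))))

  from : ∀ {π} → π ∈ map plain ps ++ map marked ps ++ overlinedTails n → IsOverpartition n π
  from p with ∈-++⁻ (map plain ps) p
  ... | inj₁ q with ∈-map⁻ plain q
  ...   | _ , r , refl = plain-isOverpartition (Equivalence.to ∈-partitions r)
  from p | inj₂ q with ∈-++⁻ (map marked ps) q
  ... | inj₂ r = proj₁ (∈-overlinedTails⁻ n r)
  ... | inj₁ r with ∈-map⁻ marked r
  ...   | _ , r′ , refl = marked-isOverpartition (Equivalence.to ∈-partitions r′)

-- Adding up the three classes.

theorem2p6 : ∀ (n : ℕ) → n ≥ 1 → + A-N>O n - + B-N>O n ≡ + 2 * + pₑ n
theorem2p6 n n≥1 = begin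
  + A-N>O n - + B-N>O n
    ≡⟨ signedCount-even-odd ℓ-N>O (overpartitions n) ⟨
  signedCount ℓ-N>O (overpartitions n)
    ≡⟨ signedCount-↭ ℓ-N>O (overpartitions-↭ n n≥1) ⟩
  signedCount ℓ-N>O (map plain ps ++ map marked ps ++ overlinedTails n)
    ≡⟨ signedCount-++ ℓ-N>O (map plain ps) _ ⟩
  signedCount ℓ-N>O (map plain ps) +ᶻ signedCount ℓ-N>O (map marked ps ++ overlinedTails n)
    ≡⟨ cong₂ _+ᶻ_ plains (trans (signedCount-++ ℓ-N>O (map marked ps) _)
         (cong₂ _+ᶻ_ markeds (overlinedTails-cancel n))) ⟩
  (+ pₑ n - + pₒ) +ᶻ ((+ pₑ n +ᶻ + pₒ) +ᶻ 0ℤ)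
    ≡⟨ double (+ pₑ n) (+ pₒ) ⟩
  + 2 * + pₑ n ∎
  where
  open ≡-Reasoning
  ps = partitions n
  pₒ = length (filter (odd? ∘ length) ps)

  isPartitions : All (IsPartition n) ps
  isPartitions = All.tabulate (Equivalence.to ∈-partitions)

  plains : signedCount ℓ-N>O (map plain ps) ≡ + pₑ n - + pₒ
  plains = trans (signedCount-map ℓ-N>O plain length (All.map ℓ-plain isPartitions))
    (signedCount-even-odd length ps)

  markeds : signedCount ℓ-N>O (map marked ps) ≡ + pₑ n +ᶻ + pₒ
  -- All signs are +1 here, giving the number of partitions. Splitting it by the parity of the
  -- length lets the odd counts cancel against those in `plains`.
  markeds = trans (signedCount-map ℓ-N>O marked (λ _ → 0) (All.map ℓ-marked isPartitions))
    (trans (signedCount-const-0 ps) (length-even-odd length ps))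

  double : ∀ e o → (e - o) +ᶻ ((e +ᶻ o) +ᶻ 0ℤ) ≡ + 2 * e
  double = solve-∀
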